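{- For every fixed integer $s \geq 2$, $Q(s,r) = (1+o(1)) \log_2 r$, where the $o(1)$-term tends to $0$ as $r$ tends to infinity. That is, for every $s\ge 2$ and every $\delta>0$ there is $r_0$ such that for all $r \ge r_0$, $(1-\delta)\log_2 r \le Q(s,r) \le (1+\delta)\log_2 r$.
   Context: The product dimension of a finite graph $G$ is the minimum possible number $d$ of proper vertex colorings of $G$ such that for every pair $u,v$ of distinct non-adjacent vertices there is at least one of the $d$ colorings in which $u$ and $v$ receive the same color. For integers $s,r \geq 2$, $K_s(r)$ denotes the graph consisting of $r$ pairwise vertex-disjoint copies of the complete graph $K_s$, and $Q(s,r)$ denotes the product dimension of $K_s(r)$. -}

module Defs where

open import Data.Empty using (⊥-elim)
open import Data.Fin using (Fin; toℕ; finToFun; funToFin)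
open import Data.Fin.Properties
  using (toℕ-injective; any?; all?; *↔×; finToFun-funToFin)
  renaming (_≟_ to _≟ᶠ_)
open import Data.Integer using (+_; -[1+_])
open import Data.Nat using (ℕ; zero; suc; _*_; _^_; _≤_; z≤n; s≤s; _≟_)
open import Data.Nat.Properties using (≤-antisym)
open import Data.Product using (Σ; ∃; ∃-syntax; _×_; _,_; proj₁; proj₂)
open import Data.Rational.Unnormalised using (ℚᵘ; mkℚᵘ; ↧ₙ_)
open import Function using (_∘_)
open import Function.Bundles using (_↔_; module Inverse)
open import Relation.Binary using (Decidable; Symmetric)
open import Relation.Nullary using (¬_; Dec; yes; no; ¬?; _×-dec_; _→-dec_)
open import Relation.Nullary.Decidable using (map′)
open import Relation.Binary.PropositionalEquality
  using (_≡_; _≢_; refl; sym; trans; cong; subst)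

record FiniteGraph : Set₁ where
  field
    V       : Set
    order   : ℕ
    enum    : Fin order ↔ V
    Adj     : V → V → Set
    Adj?    : Decidable Adj
    symm    : Symmetric Adj
    irrefl  : ∀ {v} → ¬ Adj v v

  vertex : Fin order → V
  vertex = Inverse.to enum

  index : V → Fin order
  index = Inverse.from enum

  vertex-index : ∀ v → vertex (index v) ≡ v
  vertex-index = Inverse.strictlyInverseˡ enum

module _ (G : FiniteGraph) where
  open FiniteGraph G

  Coloring : Set
  Coloring = V → ℕ

  Proper : Coloring → Set
  Proper c = ∀ u v → Adj u v → c u ≢ c v

  IsProductRepresentation : ∀ {d} → (Fin d → Coloring) → Set
  IsProductRepresentation c =
    (∀ i → Proper (c i)) ×
    (∀ u v → u ≢ v → ¬ Adj u v → ∃[ i ] c i u ≡ c i v)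

  HasProductRepresentation : ℕ → Set
  HasProductRepresentation d =
    Σ (Fin d → Coloring) IsProductRepresentation

  IsProductDimension : ℕ → Set
  IsProductDimension d =
    HasProductRepresentation d ×
    (∀ e → HasProductRepresentation e → d ≤ e)

IsLeast : (ℕ → Set) → ℕ → Set
IsLeast P m = P m × (∀ k → P k → m ≤ k)

least : {P : ℕ → Set} → (∀ n → Dec (P n)) → ∀ n → P n → ∃ (IsLeast P)
least P? zero    p = zero , p , λ _ _ → z≤n
least {P} P? (suc n) p with P? zero
... | yes p₀ = zero , p₀ , λ _ _ → z≤n
... | no ¬p₀ with least (P? ∘ suc) n p
...   | m , pm , min = suc m , pm , λ
        { zero    p₀ → ⊥-elim (¬p₀ p₀)
        ; (suc k) pk → s≤s (min k pk) }

module _ (G : FiniteGraph) where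
  open FiniteGraph G

  private
    n : ℕ
    n = order

    ∀V? : {P : V → Set} → (∀ v → Dec (P v)) → Dec (∀ v → P v)
    ∀V? {P} P? =
      map′ (λ h v → subst P (vertex-index v) (h (index v)))
           (λ h i → h (vertex i))
           (all? (P? ∘ vertex))

    _≟V_ : (u v : V) → Dec (u ≡ v)
    u ≟V v =
      map′ (λ e → trans (sym (vertex-index u)) (trans (cong vertex e) (vertex-index v)))
           (cong index) (index u ≟ᶠ index v)

    isRep? : ∀ {d} (c : Fin d → Coloring G) → Dec (IsProductRepresentation G c)
    isRep? c =
      all? (λ i → ∀V? λ u → ∀V? λ v → Adj? u v →-dec ¬? (c i u ≟ c i v))
      ×-dec
      ∀V? (λ u → ∀V? λ v → ¬? (u ≟V v) →-dec (¬? (Adj? u v)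
        →-dec any? (λ i → c i u ≟ c i v)))

    -- Only the partition into colour classes matters, so it is enough to search
    -- colourings with colours in Fin n, coded as elements of Fin (n ^ n).
    decode : Fin (n ^ n) → Coloring G
    decode k v = toℕ (finToFun k (index v))

    module _ (c : Coloring G) where
      HasColor : ℕ → ℕ → Set
      HasColor x m = Σ (Fin n) λ i → toℕ i ≡ m × c (vertex i) ≡ x

      first : ∀ v → ∃ (IsLeast (HasColor (c v)))
      first v = least
        (λ m → any? λ i → (toℕ i ≟ m) ×-dec (c (vertex i) ≟ c v))
        (toℕ (index v)) (index v , refl , cong c (vertex-index v))

      rep : V → Fin n
      rep v = proj₁ (proj₁ (proj₂ (first v)))

      rep-least : ∀ v → toℕ (rep v) ≡ proj₁ (first v)
      rep-least v = proj₁ (proj₂ (proj₁ (proj₂ (first v))))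

      rep-color : ∀ v → c (vertex (rep v)) ≡ c v
      rep-color v = proj₂ (proj₂ (proj₁ (proj₂ (first v))))

      rep-cong : ∀ u v → c u ≡ c v → rep u ≡ rep v
      rep-cong u v e = toℕ-injective (≤-antisym (le u v e) (le v u (sym e)))
        where
        le : ∀ u v → c u ≡ c v → toℕ (rep u) ≤ toℕ (rep v)
        le u v e = subst (_≤ toℕ (rep v)) (sym (rep-least u))
          (proj₂ (proj₂ (first u)) _ (rep v , refl , trans (rep-color v) (sym e)))

      encode : Fin (n ^ n)
      encode = funToFin (rep ∘ vertex)

      decode-encode : ∀ v → decode encode v ≡ toℕ (rep v)
      decode-encode v = cong toℕ
        (trans (finToFun-funToFin (rep ∘ vertex) (index v)) (cong rep (vertex-index v)))

      encode-≡ : ∀ u v → c u ≡ c v → decode encode u ≡ decode encode v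
      encode-≡ u v e =
        trans (decode-encode u) (trans (cong toℕ (rep-cong u v e)) (sym (decode-encode v)))

      encode-≡⁻¹ : ∀ u v → decode encode u ≡ decode encode v → c u ≡ c v
      encode-≡⁻¹ u v e = trans (sym (rep-color u)) (trans
        (cong (c ∘ vertex)
          (toℕ-injective (trans (sym (decode-encode u)) (trans e (decode-encode v)))))
        (rep-color v))

    hasRep? : ∀ d → Dec (HasProductRepresentation G d)
    hasRep? d = map′ (λ { (k , h) → decode ∘ finToFun k , h }) search
      (any? λ k → isRep? {d} (decode ∘ finToFun k))
      where
      search : HasProductRepresentation G d →
        Σ (Fin ((n ^ n) ^ d)) λ k → IsProductRepresentation G (decode ∘ finToFun k)
      search (c , proper , sep) = funToFin (encode ∘ c) , proper′ , sep′
        where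
        codes : ∀ i → finToFun (funToFin (encode ∘ c)) i ≡ encode (c i)
        codes = finToFun-funToFin (encode ∘ c)

        proper′ : ∀ i → Proper G (decode (finToFun (funToFin (encode ∘ c)) i))
        proper′ i = subst (Proper G ∘ decode) (sym (codes i))
          (λ u v a e → proper i u v a (encode-≡⁻¹ (c i) u v e))

        sep′ : ∀ u v → u ≢ v → ¬ Adj u v →
          ∃[ i ] decode (finToFun (funToFin (encode ∘ c)) i) u
               ≡ decode (finToFun (funToFin (encode ∘ c)) i) v
        sep′ u v u≢v ¬a with sep u v u≢v ¬a
        ... | i , e = i , subst (λ k → decode k u ≡ decode k v) (sym (codes i))
                              (encode-≡ (c i) u v e)

    injectiveColoring : Coloring G
    injectiveColoring = toℕ ∘ index

    injective-proper : Proper G injectiveColoring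
    injective-proper u v a e = irrefl (subst (Adj u)
      (sym (trans (sym (vertex-index u)) (trans (cong vertex (toℕ-injective e)) (vertex-index v)))) a)

    -- Merges x and y and separates everything else, if x and y are non-adjacent.
    pairColoring : V → V → Coloring G
    pairColoring x y w with Adj? x y | w ≟V y
    ... | no _  | yes _ = injectiveColoring x
    ... | _     | _     = injectiveColoring w

    pair-proper : ∀ x y → Proper G (pairColoring x y)
    pair-proper x y u v a e with Adj? x y | u ≟V y | v ≟V y
    ... | yes _ | _        | _        = injective-proper u v a e
    ... | no ¬a | yes refl | yes refl = irrefl a
    ... | no ¬a | no _     | no _     = injective-proper u v a e
    ... | no ¬a | yes refl | no _     = ¬a (symm (subst (Adj y) (sym x≡v) a))
      where
      x≡v : x ≡ v
      x≡v = trans (sym (vertex-index x))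
                  (trans (cong vertex (toℕ-injective e)) (vertex-index v))
    ... | no ¬a | no _     | yes refl = ¬a (subst (λ z → Adj z y) u≡x a)
      where
      u≡x : u ≡ x
      u≡x = trans (sym (vertex-index u))
                  (trans (cong vertex (toℕ-injective e)) (vertex-index x))

    pair-merges : ∀ u v → u ≢ v → ¬ Adj u v → pairColoring u v u ≡ pairColoring u v v
    pair-merges u v u≢v ¬a with Adj? u v | u ≟V v | v ≟V v
    ... | yes a | _     | _     = ⊥-elim (¬a a)
    ... | no _  | yes e | _     = ⊥-elim (u≢v e)
    ... | no _  | no _  | yes _ = refl
    ... | no _  | no _  | no ne = ⊥-elim (ne refl)

    hasRep-n² : HasProductRepresentation G (n * n)
    hasRep-n² = col , (λ i → pair-proper _ _) , sep
      where
      col : Fin (n * n) → Coloring G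
      col i = pairColoring (vertex (proj₁ (Inverse.to *↔× i)))
                           (vertex (proj₂ (Inverse.to (*↔× {n} {n}) i)))

      sep : ∀ u v → u ≢ v → ¬ Adj u v → ∃[ i ] col i u ≡ col i v
      sep u v u≢v ¬a = Inverse.from *↔× (index u , index v) ,
        subst (λ (i , j) → Merges (vertex i) (vertex j))
          (sym (Inverse.strictlyInverseˡ *↔× (index u , index v)))
          (subst (λ x → Merges x (vertex (index v))) (sym (vertex-index u))
            (subst (Merges u) (sym (vertex-index v)) (pair-merges u v u≢v ¬a)))
        where
        Merges : V → V → Set
        Merges x y = pairColoring x y u ≡ pairColoring x y v

  productDimension-exists : ∃ (IsProductDimension G)
  productDimension-exists = least hasRep? (n * n) hasRep-n²

  productDimension : ℕ
  productDimension = proj₁ productDimension-exists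

  productDimension-correct : IsProductDimension G productDimension
  productDimension-correct = proj₂ productDimension-exists

-- The vertex (i , a) is the a-th vertex of the i-th copy of K_s.
K : (s r : ℕ) → FiniteGraph
K s r = record
  { V      = Fin r × Fin s
  ; order  = r * s
  ; enum   = *↔×
  ; Adj    = λ u v → proj₁ u ≡ proj₁ v × proj₂ u ≢ proj₂ v
  ; Adj?   = λ u v → (proj₁ u ≟ᶠ proj₁ v) ×-dec ¬? (proj₂ u ≟ᶠ proj₂ v)
  ; symm   = λ (e , ne) → sym e , ne ∘ sym
  ; irrefl = λ (_ , ne) → ne refl
  }

Q : (s r : ℕ) → ℕ
Q s r = productDimension (K s r)

-- For r ≥ 1 and c = p / q with q ≥ 1, the real inequality c log₂ r ≤ d is
-- r ^ p ≤ 2 ^ (d q), exponentiation base 2 being increasing; when p < 0 the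
-- power of r is moved to the other side.  Likewise for d ≤ c log₂ r.
-- For r = 0 the logarithm is undefined and these relations carry no meaning.

infix 4 _·log₂_≤ʳ_ _≤ˡ_·log₂_

_·log₂_≤ʳ_ : ℚᵘ → ℕ → ℕ → Set
c@(mkℚᵘ (+ p)    _) ·log₂ r ≤ʳ d = r ^ p ≤ 2 ^ (d * ↧ₙ c)
c@(mkℚᵘ -[1+ p ] _) ·log₂ r ≤ʳ d = 1 ≤ 2 ^ (d * ↧ₙ c) * r ^ suc p

_≤ˡ_·log₂_ : ℕ → ℚᵘ → ℕ → Set
d ≤ˡ c@(mkℚᵘ (+ p)    _) ·log₂ r = 2 ^ (d * ↧ₙ c) ≤ r ^ p
d ≤ˡ c@(mkℚᵘ -[1+ p ] _) ·log₂ r = 2 ^ (d * ↧ₙ c) * r ^ suc p ≤ 1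

{-# OPTIONS --safe #-}

-- Lower bound.  For a representation c₁ … c_d, the matrix with entries
-- ∏ₖ (cₖ(i , 0) − cₖ(j , 1)) is diagonal with nonzero diagonal and has rank at
-- most 2ᵈ, so r ≤ 2ᵈ.
--
-- Upper bound.  It suffices to find r words over (ℤ/2)ˢ such that any two of them
-- differ by each of the L = s² vectors eₐ + e_b in some column.  Adding one
-- difference to the list costs only a factor (m + 1) / m in length, so there are
-- 2^(m^L) such words of length (m + 1)^L, and m can be taken arbitrarily large.
module Submission where

open import Defs
open import Data.Nat using (ℕ; _≤_)
open import Data.Product using (∃-syntax; _×_)
open import Data.Rational.Unnormalised using (ℚᵘ; 0ℚᵘ; 1ℚᵘ; _+_; _-_; _<_)

open import Data.Bool as Bool using (Bool; true; false; _∧_; _xor_)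
import Data.Bool.Properties as Bool
open import Data.Empty using (⊥-elim)
open import Data.Fin as Fin
  using (Fin; zero; suc; toℕ; fromℕ<; inject≤; combine; remQuot; finToFun; funToFin)
import Data.Fin.Properties as Fin
open import Data.Integer as ℤ using (ℤ; +_; -[1+_]; 0ℤ; 1ℤ)
import Data.Integer.Properties as ℤ
import Data.Integer.Tactic.RingSolver as ℤ
open import Data.List using (List; []; _∷_; length; map; allFin; cartesianProduct)
open import Data.List.Membership.Propositional using (_∈_)
open import Data.List.Membership.Propositional.Properties
  using (∈-allFin; ∈-cartesianProduct⁺; ∈-map⁺)
open import Data.List.Relation.Unary.Any using (here; there)
open import Data.Nat as ℕ using (zero; suc; _*_; _^_; z≤n; s≤s)
import Data.Nat.Properties as ℕ
import Data.Nat.Tactic.RingSolver as ℕ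
open import Data.Product using (Σ; _,_; proj₁; proj₂)
open import Data.Rational.Unnormalised as ℚᵘ using (mkℚᵘ)
import Data.Rational.Unnormalised.Properties as ℚᵘ
open import Data.Sum using (inj₁; inj₂; [_,_]′)
open import Data.Vec.Functional using (removeAt; _++_)
open import Function using (_∘_)
open import Function.Bundles using (module Inverse)
open import Relation.Nullary using (¬_; Dec; yes; no; does; ¬?)
open import Relation.Nullary.Decidable using (dec-true; decidable-stable)
open import Relation.Binary.PropositionalEquality
open import Algebra.Properties.CommutativeMonoid.Sum ℤ.+-0-commutativeMonoid
  using (sum; sum-cong-≗; sum-remove)

-- Integer dot products and the rank of a diagonal matrix.

infix 7 _·_

_·_ : ∀ {n} → (Fin n → ℤ) → (Fin n → ℤ) → ℤ
u · w = sum λ k → u k ℤ.* w k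

·-zero : ∀ {n} (u w : Fin n → ℤ) → (∀ k → u k ≡ 0ℤ) → u · w ≡ 0ℤ
·-zero {zero}  u w u≡0 = refl
·-zero {suc n} u w u≡0 =
  cong₂ ℤ._+_ (cong (ℤ._* w zero) (u≡0 zero)) (·-zero (u ∘ suc) (w ∘ suc) (u≡0 ∘ suc))

·-nonzero⇒entry : ∀ {n} (u w : Fin n → ℤ) → u · w ≢ 0ℤ → ∃[ k ] u k ≢ 0ℤ
·-nonzero⇒entry u w u·w≢0 =
  Fin.¬∀⟶∃¬ _ (λ k → u k ≡ 0ℤ) (λ k → u k ℤ.≟ 0ℤ) (u·w≢0 ∘ ·-zero u w)

·-combination : ∀ {n} p q (x y w : Fin n → ℤ) →
  (λ k → p ℤ.* x k ℤ.- q ℤ.* y k) · w ≡ p ℤ.* (x · w) ℤ.- q ℤ.* (y · w)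
·-combination {zero}  p q x y w = lemma p q
  where
  lemma : ∀ p q → 0ℤ ≡ p ℤ.* 0ℤ ℤ.- q ℤ.* 0ℤ
  lemma = ℤ.solve-∀
·-combination {suc n} p q x y w = trans
  (cong (ℤ._+_ ((p ℤ.* x zero ℤ.- q ℤ.* y zero) ℤ.* w zero))
        (·-combination p q (x ∘ suc) (y ∘ suc) (w ∘ suc)))
  (lemma p q (x zero) (y zero) (w zero) ((x ∘ suc) · (w ∘ suc)) ((y ∘ suc) · (w ∘ suc)))
  where
  lemma : ∀ p q a b c X Y →
    (p ℤ.* a ℤ.- q ℤ.* b) ℤ.* c ℤ.+ (p ℤ.* X ℤ.- q ℤ.* Y) ≡
    p ℤ.* (a ℤ.* c ℤ.+ X) ℤ.- q ℤ.* (b ℤ.* c ℤ.+ Y)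
  lemma = ℤ.solve-∀

·-++ : ∀ {m n} (u w : Fin m → ℤ) (x y : Fin n → ℤ) →
  (u ++ x) · (w ++ y) ≡ u · w ℤ.+ x · y
·-++ {zero}  u w x y = sym (ℤ.+-identityˡ (x · y))
·-++ {suc m} {n} u w x y = trans
  (cong (ℤ._+_ (u zero ℤ.* w zero)) (trans (tails m u w) (·-++ (u ∘ suc) (w ∘ suc) x y)))
  (sym (ℤ.+-assoc (u zero ℤ.* w zero) _ _))
  where
  -- `_++_` evaluates through `splitAt`, so its tail becomes `(u ∘ suc) ++ x` only after a case
  -- split on the index.
  tails : ∀ m (u w : Fin (suc m) → ℤ) →
    ((u ++ x) ∘ suc) · ((w ++ y) ∘ suc) ≡ ((u ∘ suc) ++ x) · ((w ∘ suc) ++ y)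
  tails m u w = sum-cong-≗ go
    where
    go : ∀ k → (u ++ x) (suc k) ℤ.* (w ++ y) (suc k) ≡
      ((u ∘ suc) ++ x) k ℤ.* ((w ∘ suc) ++ y) k
    go k with Fin.splitAt m k
    ... | inj₁ _ = refl
    ... | inj₂ _ = refl

-- Row 0 clears coordinate k of the other rows.  As row 0 is orthogonal to every
-- w j with j ≠ 0, this only multiplies the other products by the pivot p.
diagonal-rank : ∀ {r n} (u w : Fin r → Fin n → ℤ) →
  (∀ i → u i · w i ≢ 0ℤ) → (∀ i j → i ≢ j → u i · w j ≡ 0ℤ) → r ≤ n
diagonal-rank {zero}          u w diag off = z≤n
diagonal-rank {suc r} {zero}  u w diag off = ⊥-elim (diag zero refl)
diagonal-rank {suc r} {suc n} u w diag off =
  s≤s (diagonal-rank u′ w′ diag′ off′)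
  where
  open ≡-Reasoning
  pivot = ·-nonzero⇒entry (u zero) (w zero) (diag zero)
  k = proj₁ pivot
  p = u zero k

  -- Elimination without division keeps the entries in ℤ.
  u′ : Fin r → Fin n → ℤ
  u′ i l = p ℤ.* removeAt (u (suc i)) k l ℤ.- u (suc i) k ℤ.* removeAt (u zero) k l

  w′ : Fin r → Fin n → ℤ
  w′ j = removeAt (w (suc j)) k

  removed : ∀ i j → u i · w j ≡ u i k ℤ.* w j k ℤ.+ removeAt (u i) k · removeAt (w j) k
  removed i j = sum-remove (λ l → u i l ℤ.* w j l)

  -- Both rows contribute p q c at the deleted coordinate, so deleting it does not change the dot
  -- product of the combination.
  cancel : ∀ p q c X Y → p ℤ.* X ℤ.- q ℤ.* Y ≡
    p ℤ.* (q ℤ.* c ℤ.+ X) ℤ.- q ℤ.* (p ℤ.* c ℤ.+ Y)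
  cancel = ℤ.solve-∀

  drop-zero : ∀ a b → a ℤ.- b ℤ.* 0ℤ ≡ a
  drop-zero = ℤ.solve-∀

  product′ : ∀ i j → u′ i · w′ j ≡ p ℤ.* (u (suc i) · w (suc j))
  product′ i j = begin
    u′ i · w′ j
      ≡⟨ ·-combination p q (removeAt (u (suc i)) k) (removeAt (u zero) k) (w′ j) ⟩
    p ℤ.* (removeAt (u (suc i)) k · w′ j) ℤ.- q ℤ.* (removeAt (u zero) k · w′ j)
      ≡⟨ cancel p q (w (suc j) k) _ _ ⟩
    p ℤ.* (q ℤ.* w (suc j) k ℤ.+ removeAt (u (suc i)) k · w′ j)
      ℤ.- q ℤ.* (p ℤ.* w (suc j) k ℤ.+ removeAt (u zero) k · w′ j)
      ≡⟨ cong₂ (λ X Y → p ℤ.* X ℤ.- q ℤ.* Y) (removed (suc i) (suc j)) (removed zero (suc j)) ⟨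
    p ℤ.* (u (suc i) · w (suc j)) ℤ.- q ℤ.* (u zero · w (suc j))
      ≡⟨ cong (λ Y → p ℤ.* (u (suc i) · w (suc j)) ℤ.- q ℤ.* Y) (off zero (suc j) λ ()) ⟩
    p ℤ.* (u (suc i) · w (suc j)) ℤ.- q ℤ.* 0ℤ
      ≡⟨ drop-zero _ q ⟩
    p ℤ.* (u (suc i) · w (suc j)) ∎
    where q = u (suc i) k

  diag′ : ∀ i → u′ i · w′ i ≢ 0ℤ
  diag′ i e = [ proj₂ pivot , diag (suc i) ]′
    (ℤ.i*j≡0⇒i≡0∨j≡0 p (trans (sym (product′ i i)) e))

  off′ : ∀ i j → i ≢ j → u′ i · w′ j ≡ 0ℤ
  off′ i j i≢j = trans (product′ i j)
    (trans (cong (p ℤ.*_) (off (suc i) (suc j) (i≢j ∘ Fin.suc-injective))) (ℤ.*-zeroʳ p))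

-- Products of differences and the lower bound.

∏ : ∀ {n} → (Fin n → ℤ) → ℤ
∏ {zero}  f = 1ℤ
∏ {suc n} f = f zero ℤ.* ∏ (f ∘ suc)

∏-nonzero : ∀ {n} (f : Fin n → ℤ) → (∀ i → f i ≢ 0ℤ) → ∏ f ≢ 0ℤ
∏-nonzero {zero}  f f≢0 ()
∏-nonzero {suc n} f f≢0 e =
  [ f≢0 zero , ∏-nonzero (f ∘ suc) (f≢0 ∘ suc) ]′ (ℤ.i*j≡0⇒i≡0∨j≡0 (f zero) e)

∏-zero : ∀ {n} (f : Fin n → ℤ) i → f i ≡ 0ℤ → ∏ f ≡ 0ℤ
∏-zero f zero    e = cong (ℤ._* ∏ (f ∘ suc)) e
∏-zero f (suc i) e = trans (cong (f zero ℤ.*_) (∏-zero (f ∘ suc) i e)) (ℤ.*-zeroʳ (f zero))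

-- Each factor x − y doubles the length of the factorisation:
-- (x − y) (u · w) = (x u) · w + u · (− y w).
difference-product-factorises : ∀ {I J : Set} {d} (x : Fin d → I → ℤ) (y : Fin d → J → ℤ) →
  ∃[ n ] n ≤ 2 ^ d × Σ (I → Fin n → ℤ) λ u → Σ (J → Fin n → ℤ) λ w →
    ∀ i j → u i · w j ≡ ∏ (λ k → x k i ℤ.- y k j)
difference-product-factorises {d = zero}  x y =
  1 , ℕ.≤-refl , (λ _ _ → 1ℤ) , (λ _ _ → 1ℤ) , λ _ _ → refl
difference-product-factorises {d = suc d} x y
  with n , n≤ , u , w , uw ← difference-product-factorises (x ∘ suc) (y ∘ suc) =
  n ℕ.+ n ,
  -- `2 ^ suc d` unfolds to `2 ^ d + (2 ^ d + 0)`, hence the second bound ends in `0`.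
  ℕ.+-mono-≤ n≤ (ℕ.≤-trans n≤ (ℕ.m≤m+n _ 0)) ,
  (λ i → scale (x zero i) (u i) ++ u i) ,
  (λ j → w j ++ scale (ℤ.- y zero j) (w j)) ,
  λ i j → trans (·-++ (scale (x zero i) (u i)) (w j) (u i) (scale (ℤ.- y zero j) (w j)))
    (trans (distribute (x zero i) (y zero j) (u i) (w j))
           (cong ((x zero i ℤ.- y zero j) ℤ.*_) (uw i j)))
  where
  scale : ∀ {n} → ℤ → (Fin n → ℤ) → Fin n → ℤ
  scale c v k = c ℤ.* v k

  distribute : ∀ {n} a b (u w : Fin n → ℤ) →
    scale a u · w ℤ.+ u · scale (ℤ.- b) w ≡ (a ℤ.- b) ℤ.* (u · w)
  distribute {zero}  a b u w = sym (ℤ.*-zeroʳ (a ℤ.- b))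
  distribute {suc n} a b u w = trans
    (lemma a b (u zero) (w zero) _ _)
    (trans (cong (ℤ._+_ ((a ℤ.- b) ℤ.* (u zero ℤ.* w zero)))
                 (distribute a b (u ∘ suc) (w ∘ suc)))
           (sym (ℤ.*-distribˡ-+ (a ℤ.- b) (u zero ℤ.* w zero) _)))
    where
    lemma : ∀ a b c d X Y → (a ℤ.* c ℤ.* d ℤ.+ X) ℤ.+ (c ℤ.* (ℤ.- b ℤ.* d) ℤ.+ Y) ≡
      (a ℤ.- b) ℤ.* (c ℤ.* d) ℤ.+ (X ℤ.+ Y)
    lemma = ℤ.solve-∀

-- Vertices 0 and 1 of one clique are adjacent, so no factor of a diagonal entry vanishes. In
-- different cliques they are non-adjacent, and the colouring that merges them gives a zero factor.
representation⇒r≤2^d : ∀ {s r d} → 2 ≤ s → HasProductRepresentation (K s r) d → r ≤ 2 ^ d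
representation⇒r≤2^d {r = r} (s≤s (s≤s _)) (c , proper , merge)
  with n , n≤ , u , w , uw ← difference-product-factorises
         (λ k (i : Fin r) → + c k (i , zero)) (λ k (j : Fin r) → + c k (j , suc zero)) =
  ℕ.≤-trans (diagonal-rank u w
    (λ i e → ∏-nonzero _ (λ k e → proper k (i , zero) (i , suc zero) (refl , λ ())
                                     (ℤ.+-injective (ℤ.i-j≡0⇒i≡j _ _ e)))
               (trans (sym (uw i i)) e))
    (λ i j i≢j → let k , e = merge (i , zero) (j , suc zero) (i≢j ∘ cong proj₁) (i≢j ∘ proj₁) in
      trans (uw i j) (∏-zero _ k (ℤ.i≡j⇒i-j≡0 (cong +_ e)))))
    n≤

-- Bit strings, padded sequences and changes of a predicate along ℕ.

Bits : ℕ → Set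
Bits n = Fin n → Bool

-- Indices range over ℕ so that the row after the last one still has a value.
padded : ∀ {A : Set} {n} → A → (Fin n → A) → ℕ → A
padded {n = zero}  a f t       = a
padded {n = suc n} a f zero    = f zero
padded {n = suc n} a f (suc t) = padded a (f ∘ suc) t

padded-toℕ : ∀ {A : Set} {n} (a : A) (f : Fin n → A) i → padded a f (toℕ i) ≡ f i
padded-toℕ a f zero    = refl
padded-toℕ a f (suc i) = padded-toℕ a (f ∘ suc) i

padded-outside : ∀ {A : Set} {n} (a : A) (f : Fin n → A) → padded a f n ≡ a
padded-outside {n = zero}  a f = refl
padded-outside {n = suc n} a f = padded-outside a (f ∘ suc)

-- The relation is left open because rows are compared by `_≗_` and bits by `_≡_`.
padded-cong : ∀ {A : Set} {n} (_~_ : A → A → Set) {a : A} → a ~ a → {f g : Fin n → A} →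
  (∀ i → f i ~ g i) → ∀ t → padded a f t ~ padded a g t
padded-cong {n = zero}  _~_ a~a f~g t       = a~a
padded-cong {n = suc n} _~_ a~a f~g zero    = f~g zero
padded-cong {n = suc n} _~_ a~a f~g (suc t) = padded-cong _~_ a~a (f~g ∘ suc) t

-- The scan from 0 stops where `E` first fails. It finds both the first differing row of two
-- messages and the size of the code in `bracket`.
first-exit : {E : ℕ → Set} → (∀ t → Dec (E t)) → ∀ k → E 0 → ¬ E k →
  ∃[ t ] t ℕ.< k × E t × ¬ E (suc t)
first-exit E? zero    e₀ ¬eₖ = ⊥-elim (¬eₖ e₀)
first-exit E? (suc k) e₀ ¬eₖ with E? 1
... | no ¬e₁ = 0 , s≤s z≤n , e₀ , ¬e₁
... | yes e₁ with t , t<k , e , ¬e ← first-exit (E? ∘ suc) k e₁ ¬eₖ =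
  suc t , s≤s t<k , e , ¬e

-- Shifted by `k`, this is `first-exit` for the negation. It finds the first return to `E` after
-- `k`, and any such return serves the code.
last-exit : {E : ℕ → Set} → (∀ t → Dec (E t)) → ∀ k n → k ≤ n → ¬ E k → E n →
  ∃[ t ] t ℕ.< n × ¬ E t × E (suc t)
last-exit E? zero n _ ¬eₖ eₙ
  with t , t<n , ¬e , ¬¬e ← first-exit (¬? ∘ E?) n ¬eₖ (λ ¬eₙ → ¬eₙ eₙ) =
  t , t<n , ¬e , decidable-stable (E? (suc t)) ¬¬e
last-exit E? (suc k) (suc n) (s≤s k≤n) ¬eₖ eₙ
  with t , t<n , ¬e , e ← last-exit (E? ∘ suc) k n k≤n ¬eₖ eₙ =
  suc t , s≤s t<n , ¬e , e

infix 4 _≗?_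

_≗?_ : ∀ {n} (x y : Bits n) → Dec (x ≗ y)
x ≗? y = Fin.all? λ i → x i Bool.≟ y i

not-≗⇒difference : ∀ {n} {x y : Bits n} → ¬ (x ≗ y) → ∃[ i ] x i ≢ y i
not-≗⇒difference {x = x} {y} = Fin.¬∀⟶∃¬ _ _ (λ i → x i Bool.≟ y i)

≢⇒xor-true : ∀ {a b} → a ≢ b → a xor b ≡ true
≢⇒xor-true {false} {false} a≢b = ⊥-elim (a≢b refl)
≢⇒xor-true {false} {true}  a≢b = refl
≢⇒xor-true {true}  {false} a≢b = refl
≢⇒xor-true {true}  {true}  a≢b = ⊥-elim (a≢b refl)

-- For blocks whose next rows agree: the added multiples of τ coincide and drop out.
xor-cancelʳ : ∀ a b c → (a xor c) xor (b xor c) ≡ a xor b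
xor-cancelʳ false false false = refl
xor-cancelʳ false false true  = refl
xor-cancelʳ false true  false = refl
xor-cancelʳ false true  true  = refl
xor-cancelʳ true  false false = refl
xor-cancelʳ true  false true  = refl
xor-cancelʳ true  true  false = refl
xor-cancelʳ true  true  true  = refl

-- For blocks whose current rows agree: the inner words drop out, leaving the difference of the bits
-- times τ.
xor-cancelˡ-∧ : ∀ a p q b → (a xor (p ∧ b)) xor (a xor (q ∧ b)) ≡ (p xor q) ∧ b
xor-cancelˡ-∧ false p q b = sym (Bool.∧-distribʳ-xor b p q)
xor-cancelˡ-∧ true  false false false = refl
xor-cancelˡ-∧ true  false false true  = refl
xor-cancelˡ-∧ true  false true  false = refl
xor-cancelˡ-∧ true  false true  true  = refl
xor-cancelˡ-∧ true  true  false false = refl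
xor-cancelˡ-∧ true  true  false true  = refl
xor-cancelˡ-∧ true  true  true  false = refl
xor-cancelˡ-∧ true  true  true  true  = refl

xor-cancelˡ : ∀ a {b c} → a xor b ≡ a xor c → b ≡ c
xor-cancelˡ false e = e
xor-cancelˡ true  e = Bool.not-injective e

-- The passage from a realised difference eₐ + e_b to two equal colours, signs being irrelevant in
-- ℤ/2.
exchange-xor : ∀ x y a b → x xor y ≡ a xor b → x xor a ≡ y xor b
exchange-xor false false false false e = refl
exchange-xor false false true  true  e = refl
exchange-xor false true  false true  e = refl
exchange-xor false true  true  false e = refl
exchange-xor true  false false true  e = refl
exchange-xor true  false true  false e = refl
exchange-xor true  true  false false e = refl
exchange-xor true  true  true  true  e = refl

-- Codes that realise prescribed differences.

-- The letters of a word are vectors of (ℤ/2)ˢ, with xor as their difference.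
-- The field n≤d leaves room to write a message out, padded, as a bit string of length d.
record Code {s} (n d : ℕ) (τs : List (Bits s)) : Set where
  field
    n≤d       : n ≤ d
    word      : Bits n → Fin d → Bits s
    word-cong : ∀ {x y} → x ≗ y → ∀ t → word x t ≗ word y t
    separates : ∀ {x y} → ¬ (x ≗ y) → ∀ {τ} → τ ∈ τs →
      ∃[ t ] (∀ i → word x t i xor word y t i ≡ τ i)

trivial : ∀ {s} → Code {s} 1 1 []
trivial = record
  { n≤d       = ℕ.≤-refl
  ; word      = λ _ _ _ → false
  ; word-cong = λ _ _ _ → refl
  ; separates = λ _ ()
  }

-- A message is a sequence of m rows z₁ … zₘ, with z₀ = zₘ₊₁ = 0.  Block t of its
-- word is word C zₜ + zₜ₊₁ τ.  At the last index where two messages differ the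
-- first summand separates them; just before the first such index the second does.
extend : ∀ {s n d} m (τ : Bits s) {τs} → Code n d τs → Code (m * n) (suc m * d) (τ ∷ τs)
extend {s} {n} {d} m τ {τs} C = record
  { n≤d       = ℕ.*-mono-≤ (ℕ.n≤1+n m) n≤d
  ; word      = λ z c → let t , k = remQuot {suc m} d c in block z t k
  ; word-cong = λ x≗y c → let t , k = remQuot {suc m} d c in block-cong x≗y t k
  ; separates = λ {x} {y} x≭y {τ} τ∈ → let t , k , e = block-separates x≭y τ∈ in
      combine t k ,
      subst (λ (t , k) → ∀ i → block x t k i xor block y t k i ≡ τ i)
            (sym (Fin.remQuot-combine t k)) e
  }
  where
  open Code C

  zeros : Bits n
  zeros _ = false

  row : Bits (m * n) → Fin m → Bits n
  row z j k = z (combine j k)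

  rows : Bits (m * n) → ℕ → Bits n
  rows z zero    = zeros
  -- Row `j` of the message sits at index `suc j`; the default supplies the zero row at `suc m`.
  rows z (suc t) = padded zeros (row z) t

  rows-cong : ∀ {x y} → x ≗ y → ∀ t → rows x t ≗ rows y t
  rows-cong x≗y zero    _ = refl
  rows-cong {x} {y} x≗y (suc t) =
    padded-cong _≗_ {zeros} (λ _ → refl) {row x} {row y} (λ j k → x≗y (combine j k)) t

  rows-last : ∀ x y → rows x (suc m) ≗ rows y (suc m)
  rows-last x y k = cong (λ r → r k)
    (trans (padded-outside zeros (row x)) (sym (padded-outside zeros (row y))))

  bit : Bits (m * n) → Fin (suc m) → Fin d → Bool
  -- Bit `k` of the next row decides whether τ is added at position `k`; positions from `n` on get
  -- `false`.
  bit z t k = padded false (rows z (suc (toℕ t))) (toℕ k)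

  block : Bits (m * n) → Fin (suc m) → Fin d → Bits s
  block z t k i = word (rows z (toℕ t)) k i xor (bit z t k ∧ τ i)

  block-cong : ∀ {x y} → x ≗ y → ∀ t k → block x t k ≗ block y t k
  block-cong x≗y t k i = cong₂ (λ a b → a xor (b ∧ τ i))
    (word-cong (rows-cong x≗y (toℕ t)) k i)
    (padded-cong _≡_ refl (rows-cong x≗y (suc (toℕ t))) (toℕ k))

  differing-row : ∀ {x y} → ¬ (x ≗ y) → ∃[ j ] j ≤ m × ¬ (rows x j ≗ rows y j)
  differing-row {x} {y} x≭y with c , xc≢yc ← not-≗⇒difference x≭y =
    suc (toℕ j) , Fin.toℕ<n j , λ e → xc≢yc (begin
      x c                     ≡⟨ cong x (Fin.combine-remQuot {m} n c) ⟨
      x (combine j k)         ≡⟨ cong (λ r → r k) (padded-toℕ zeros (row x) j) ⟨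
      rows x (suc (toℕ j)) k  ≡⟨ e k ⟩
      rows y (suc (toℕ j)) k  ≡⟨ cong (λ r → r k) (padded-toℕ zeros (row y) j) ⟩
      y (combine j k)         ≡⟨ cong y (Fin.combine-remQuot {m} n c) ⟩
      y c                     ∎)
    where
    open ≡-Reasoning
    j = proj₁ (remQuot {m} n c)
    k = proj₂ (remQuot {m} n c)

  at : ∀ (P : ℕ → Set) {t} → t ℕ.< suc m → P t → Σ (Fin (suc m)) (P ∘ toℕ)
  at P t<1+m p = fromℕ< t<1+m , subst P (sym (Fin.toℕ-fromℕ< t<1+m)) p

  block-separates : ∀ {x y} → ¬ (x ≗ y) → ∀ {υ} → υ ∈ τ ∷ τs →
    ∃[ t ] ∃[ k ] (∀ i → block x t k i xor block y t k i ≡ υ i)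
  block-separates {x} {y} x≭y (here refl)
    with j , j≤m , rows≭ ← differing-row x≭y
    -- The rows at index 0 agree, so agreement is lost at or before `j`.
    with t , t<j , same , diff ← first-exit (λ t → rows x t ≗? rows y t) j (λ _ → refl) rows≭
    with t , same , diff ← at (λ t → (rows x t ≗ rows y t) × ¬ (rows x (suc t) ≗ rows y (suc t)))
                              (ℕ.m<n⇒m<1+n (ℕ.<-≤-trans t<j j≤m)) (same , diff)
    with k , xk≢yk ← not-≗⇒difference diff =
    t , k′ k , λ i → begin
      block x t (k′ k) i xor block y t (k′ k) i
        ≡⟨ cong (λ a → (a xor (bit x t (k′ k) ∧ τ i)) xor block y t (k′ k) i)
                (word-cong same (k′ k) i) ⟩
      (word (rows y (toℕ t)) (k′ k) i xor (bit x t (k′ k) ∧ τ i)) xor block y t (k′ k) i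
        ≡⟨ xor-cancelˡ-∧ (word (rows y (toℕ t)) (k′ k) i) (bit x t (k′ k)) (bit y t (k′ k))
                         (τ i) ⟩
      (bit x t (k′ k) xor bit y t (k′ k)) ∧ τ i
        ≡⟨ cong (_∧ τ i) (≢⇒xor-true λ e →
                  xk≢yk (trans (sym (bit≡ x t k)) (trans e (bit≡ y t k)))) ⟩
      τ i ∎
    where
    open ≡-Reasoning
    k′ : Fin n → Fin d
    k′ k = inject≤ k n≤d
    bit≡ : ∀ z t k → bit z t (k′ k) ≡ rows z (suc (toℕ t)) k
    bit≡ z t k = trans (cong (padded false (rows z (suc (toℕ t)))) (Fin.toℕ-inject≤ k n≤d))
                       (padded-toℕ false _ k)
  block-separates {x} {y} x≭y (there υ∈)
    with j , j≤m , rows≭ ← differing-row x≭y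
    -- The rows at `suc m` agree again, so the disagreement at `j` has to end.
    with t , t≤m , diff , same ← last-exit (λ t → rows x t ≗? rows y t) j (suc m)
                                   (ℕ.m≤n⇒m≤1+n j≤m) rows≭ (rows-last x y)
    with t , diff , same ← at (λ t → ¬ (rows x t ≗ rows y t) × (rows x (suc t) ≗ rows y (suc t)))
                              t≤m (diff , same)
    with k , e ← separates diff υ∈ =
    t , k , λ i → begin
      block x t k i xor block y t k i
        ≡⟨ cong (λ b → (word (rows x (toℕ t)) k i xor (b ∧ τ i)) xor block y t k i)
                (padded-cong _≡_ refl same (toℕ k)) ⟩
      (word (rows x (toℕ t)) k i xor (bit y t k ∧ τ i)) xor block y t k i
        ≡⟨ xor-cancelʳ (word (rows x (toℕ t)) k i) (word (rows y (toℕ t)) k i)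
                       (bit y t k ∧ τ i) ⟩
      word (rows x (toℕ t)) k i xor word (rows y (toℕ t)) k i
        ≡⟨ e i ⟩
      _ ∎
    where open ≡-Reasoning

code : ∀ {s} m (τs : List (Bits s)) → Code (m ^ length τs) (suc m ^ length τs) τs
code m []       = trivial
code m (τ ∷ τs) = extend m τ (code m τs)

-- Numbering of messages and colours; from codes to representations.

funToFin-cong : ∀ {m n} {f g : Fin m → Fin n} → f ≗ g → funToFin f ≡ funToFin g
funToFin-cong {zero}  f≗g = refl
funToFin-cong {suc m} f≗g = cong₂ combine (f≗g zero) (funToFin-cong (f≗g ∘ suc))

fromBool : Bool → Fin 2
fromBool = Inverse.from Fin.2↔Bool

toBool : Fin 2 → Bool
toBool = Inverse.to Fin.2↔Bool

bits : ∀ {n} → Fin (2 ^ n) → Bits n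
bits i = toBool ∘ finToFun i

bits-injective : ∀ {n} {i j : Fin (2 ^ n)} → bits {n} i ≗ bits j → i ≡ j
bits-injective {n} {i} {j} e = begin
  i                              ≡⟨ Fin.funToFin-finToFin {n} {2} i ⟨
  funToFin (finToFun {2} {n} i)  ≡⟨ funToFin-cong {n} {2} same ⟩
  funToFin (finToFun {2} {n} j)  ≡⟨ Fin.funToFin-finToFin {n} {2} j ⟩
  j                              ∎
  where
  open ≡-Reasoning
  same : finToFun {2} {n} i ≗ finToFun j
  same k = begin
    finToFun i k             ≡⟨ Inverse.strictlyInverseʳ Fin.2↔Bool (finToFun i k) ⟨
    fromBool (bits {n} i k)  ≡⟨ cong fromBool (e k) ⟩
    fromBool (bits {n} j k)  ≡⟨ Inverse.strictlyInverseʳ Fin.2↔Bool (finToFun j k) ⟩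
    finToFun j k             ∎

colour : ∀ {s} → Bits s → ℕ
colour u = toℕ (funToFin (fromBool ∘ u))

colour-cong : ∀ {s} {u v : Bits s} → u ≗ v → colour u ≡ colour v
colour-cong u≗v = cong toℕ (funToFin-cong (cong fromBool ∘ u≗v))

colour-injective : ∀ {s} {u v : Bits s} → colour u ≡ colour v → u ≗ v
colour-injective {s} {u} {v} e i = begin
  u i
    ≡⟨ recovered u ⟨
  toBool (finToFun (funToFin (fromBool ∘ u)) i)
    ≡⟨ cong (λ c → toBool (finToFun c i)) (Fin.toℕ-injective e) ⟩
  toBool (finToFun (funToFin (fromBool ∘ v)) i)
    ≡⟨ recovered v ⟩
  v i ∎
  where
  open ≡-Reasoning
  recovered : ∀ u → toBool (finToFun (funToFin (fromBool ∘ u)) i) ≡ u i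
  recovered u = trans (cong toBool (Fin.finToFun-funToFin (fromBool ∘ u) i))
                      (Inverse.strictlyInverseˡ Fin.2↔Bool (u i))

-- The standard basis vector eₐ of (ℤ/2)ˢ.
unit : ∀ {s} → Fin s → Bits s
unit a i = does (a Fin.≟ i)

unit-injective : ∀ {s} {a b : Fin s} → unit a ≗ unit b → a ≡ b
unit-injective {a = a} {b} e with b Fin.≟ a | e a
... | yes b≡a | _  = sym b≡a
... | no _    | eₐ with () ← trans (sym (dec-true (a Fin.≟ a) refl)) eₐ

-- The vector eₐ + e_b. The case a = b is kept: vertices with the same index in different cliques
-- must also be merged.
unitDifference : ∀ {s} → Fin s × Fin s → Bits s
unitDifference (a , b) i = unit a i xor unit b i

unitDifferences : ∀ s → List (Bits s)
unitDifferences s = map unitDifference (cartesianProduct (allFin s) (allFin s))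

-- The column u ∈ (ℤ/2)ˢ gives the a-th vertex of its clique the colour u + eₐ, so
-- that vertices a and b of cliques with columns u and v get the same colour iff
-- u − v = eₐ − e_b.
code⇒representation : ∀ {s r n d} → Code n d (unitDifferences s) → r ≤ 2 ^ n →
  HasProductRepresentation (K s r) d
code⇒representation {s} {r} {n} {d} C r≤2^n = colouring , proper , merge
  where
  open Code C

  message : Fin r → Bits n
  message i = bits (inject≤ i r≤2^n)

  message-injective : ∀ {i j} → message i ≗ message j → i ≡ j
  message-injective e = Fin.inject≤-injective r≤2^n r≤2^n _ _ (bits-injective {n} e)

  vector : Fin d → Fin r × Fin s → Bits s
  vector t (i , a) k = word (message i) t k xor unit a k

  colouring : Fin d → Coloring (K s r)
  colouring t v = colour (vector t v)

  proper : ∀ t → Proper (K s r) (colouring t)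
  proper t (i , a) (.i , b) (refl , a≢b) e = a≢b (unit-injective λ k →
    xor-cancelˡ (word (message i) t k) (colour-injective e k))

  distinct-cliques : ∀ {i j : Fin r} {a b : Fin s} → (i , a) ≢ (j , b) →
    ¬ FiniteGraph.Adj (K s r) (i , a) (j , b) → i ≢ j
  distinct-cliques u≢v ¬adj refl = ¬adj (refl , λ { refl → u≢v refl })

  merge : ∀ u v → u ≢ v → ¬ FiniteGraph.Adj (K s r) u v → ∃[ t ] colouring t u ≡ colouring t v
  merge (i , a) (j , b) u≢v ¬adj
    with t , e ← separates {message i} {message j} (distinct-cliques u≢v ¬adj ∘ message-injective)
                   (∈-map⁺ unitDifference (∈-cartesianProduct⁺ (∈-allFin a) (∈-allFin b))) =
    t , colour-cong λ k → exchange-xor (word (message i) t k) (word (message j) t k) _ _ (e k)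

-- Growth estimates and the choice of `m`.

-- With q′ = 2 q + 1, use (1 + 1/q′)² ≤ 1 + 1/q.
[m+2]^L-growth : ∀ L q → ∃[ m₀ ] (∀ m → m₀ ≤ m → q * (2 ℕ.+ m) ^ L ≤ suc q * m ^ L)
[m+2]^L-growth zero    q = 0 , λ m _ → ℕ.*-monoˡ-≤ 1 (ℕ.n≤1+n q)
[m+2]^L-growth (suc L) q with m₁ , bound ← [m+2]^L-growth L (1 ℕ.+ 2 * q) =
  m₁ ℕ.⊔ 2 * q′ , λ m m₀≤m →
    let X = m ^ L ; Y = (2 ℕ.+ m) ^ L in
    -- The factor `4 * suc q` completes the squares: 4 q (q + 1) + 1 = q′² and 4 (q + 1)² = (q′ +
    -- 1)².
    ℕ.*-cancelˡ-≤ (4 * suc q) (begin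
      4 * suc q * (q * ((2 ℕ.+ m) * Y))
        ≤⟨ ℕ.m≤m+n _ ((2 ℕ.+ m) * Y) ⟩
      4 * suc q * (q * ((2 ℕ.+ m) * Y)) ℕ.+ (2 ℕ.+ m) * Y
        ≡⟨ square q (2 ℕ.+ m) Y ⟩
      (q′ * (2 ℕ.+ m)) * (q′ * Y)
        ≤⟨ ℕ.*-mono-≤ (linear m (ℕ.≤-trans (ℕ.m≤n⊔m m₁ _) m₀≤m))
                      (bound m (ℕ.≤-trans (ℕ.m≤m⊔n m₁ _) m₀≤m)) ⟩
      (suc q′ * m) * (suc q′ * X)
        ≡⟨ square′ q m X ⟩
      4 * suc q * (suc q * (m * X)) ∎)
  where
  open ℕ.≤-Reasoning
  q′ = 1 ℕ.+ 2 * q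

  linear : ∀ m → 2 * q′ ≤ m → q′ * (2 ℕ.+ m) ≤ suc q′ * m
  linear m 2q′≤m = begin
    q′ * (2 ℕ.+ m)     ≡⟨ ℕ.*-distribˡ-+ q′ 2 m ⟩
    q′ * 2 ℕ.+ q′ * m  ≡⟨ cong (ℕ._+ q′ * m) (ℕ.*-comm q′ 2) ⟩
    2 * q′ ℕ.+ q′ * m  ≤⟨ ℕ.+-monoˡ-≤ (q′ * m) 2q′≤m ⟩
    suc q′ * m         ∎

  square : ∀ q M Y → 4 * (1 ℕ.+ q) * (q * (M * Y)) ℕ.+ M * Y ≡
    ((1 ℕ.+ 2 * q) * M) * ((1 ℕ.+ 2 * q) * Y)
  square = ℕ.solve-∀

  square′ : ∀ q m X → ((2 ℕ.+ 2 * q) * m) * ((2 ℕ.+ 2 * q) * X) ≡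
    4 * (1 ℕ.+ q) * ((1 ℕ.+ q) * (m * X))
  square′ = ℕ.solve-∀

n<2^n : ∀ n → n ℕ.< 2 ^ n
n<2^n zero    = s≤s z≤n
n<2^n (suc n) = ℕ.+-mono-≤ (ℕ.m^n>0 2 n) (ℕ.≤-trans (n<2^n n) (ℕ.m≤m+n _ 0))

m≤m^n : ∀ m n → 1 ≤ n → m ≤ m ^ n
m≤m^n zero      _       _ = z≤n
m≤m^n m@(suc _) (suc n) _ = ℕ.m≤m*n m (m ^ n) {{ℕ.m^n≢0 m n}}

-- The upper bound on `r` provides a message for each clique, and the lower bound turns word length
-- back into log₂ r. The scan from `m₀` succeeds within `r` steps because 2 ^ ((r + m₀) ^ L) exceeds
-- r.
bracket : ∀ L → 1 ≤ L → ∀ m₀ r → 2 ^ (m₀ ^ L) ℕ.< r →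
  ∃[ m ] m₀ ≤ m × 2 ^ (m ^ L) ℕ.< r × r ≤ 2 ^ (suc m ^ L)
bracket L 1≤L m₀ r low
  with t , _ , below , above ← first-exit (λ t → 2 ^ ((t ℕ.+ m₀) ^ L) ℕ.<? r) r low
         (ℕ.<-asym (ℕ.<-≤-trans (n<2^n r)
           (ℕ.^-monoʳ-≤ 2 (ℕ.≤-trans (ℕ.m≤m+n r m₀) (m≤m^n (r ℕ.+ m₀) L 1≤L))))) =
  t ℕ.+ m₀ , ℕ.m≤n+m m₀ t , below , ℕ.≮⇒≥ above

-- Bounds on `Q` with rational coefficients.

Q-lower : ∀ c → c ℚᵘ.≤ 1ℚᵘ → ∀ s r → 2 ≤ s → 2 ≤ r → c ·log₂ r ≤ʳ Q s r
Q-lower (mkℚᵘ (+ p) q-1) c≤1 s r 2≤s _ = begin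
  r ^ p                  ≤⟨ ℕ.^-monoˡ-≤ p r≤2^Q ⟩
  (2 ^ Q s r) ^ p        ≡⟨ ℕ.^-*-assoc 2 (Q s r) p ⟩
  2 ^ (Q s r * p)        ≤⟨ ℕ.^-monoʳ-≤ 2 (ℕ.*-monoʳ-≤ (Q s r) p≤q) ⟩
  2 ^ (Q s r * suc q-1)  ∎
  where
  open ℕ.≤-Reasoning
  r≤2^Q : r ≤ 2 ^ Q s r
  r≤2^Q = representation⇒r≤2^d 2≤s (proj₁ (productDimension-correct (K s r)))
  p≤q : p ≤ suc q-1
  p≤q = ℤ.drop‿+≤+ (subst₂ ℤ._≤_
    (ℤ.*-identityʳ (+ p)) (ℤ.*-identityˡ (+ suc q-1)) (ℚᵘ.drop-*≤* c≤1))
-- For negative c the claim is that a product of positive naturals is at least 1.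
Q-lower (mkℚᵘ -[1+ p ] q-1) _ s (suc r-1) _ _ =
  ℕ.*-mono-≤ (ℕ.m^n>0 2 (Q s (suc r-1) * suc q-1)) (ℕ.m^n>0 (suc r-1) (suc p))

-- For c = p / q > 1 the integers satisfy q + 1 ≤ p, so it is enough that (m + 2)^L exceeds m^L by a
-- factor of at most (q + 1) / q.
Q-upper : ∀ c → 1ℚᵘ < c → ∀ s → 1 ≤ s → ∃[ r₀ ] (∀ r → r₀ ≤ r → Q s r ≤ˡ c ·log₂ r)
Q-upper (mkℚᵘ -[1+ _ ] _) (ℚᵘ.*<* ())
Q-upper (mkℚᵘ (+ p) q-1) 1<c s 1≤s
  with m₀ , growth ← [m+2]^L-growth (length (unitDifferences s)) (suc q-1) =
  -- With this threshold, `r₀ ≤ r` is literally the hypothesis 2 ^ (m₀ ^ L) < r of `bracket`.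
  suc (2 ^ (m₀ ^ L)) , bound
  where
  open ℕ.≤-Reasoning
  q = suc q-1
  L = length (unitDifferences s)

  q<p : q ℕ.< p
  q<p = ℤ.drop‿+<+ (subst₂ ℤ._<_
    (ℤ.*-identityˡ (+ q)) (ℤ.*-identityʳ (+ p)) (ℚᵘ.drop-*<* 1<c))

  1≤L : ∀ {s} → 1 ≤ s → 1 ≤ length (unitDifferences s)
  1≤L (s≤s _) = s≤s z≤n

  bound : ∀ r → 2 ^ (m₀ ^ L) ℕ.< r → 2 ^ (Q s r * q) ≤ r ^ p
  bound r low with m , m₀≤m , below , above ← bracket L (1≤L 1≤s) m₀ r low = begin
    2 ^ (Q s r * q)          ≤⟨ ℕ.^-monoʳ-≤ 2 (ℕ.*-monoˡ-≤ q Q≤) ⟩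
    2 ^ ((2 ℕ.+ m) ^ L * q)  ≡⟨ cong (2 ^_) (ℕ.*-comm ((2 ℕ.+ m) ^ L) q) ⟩
    2 ^ (q * (2 ℕ.+ m) ^ L)  ≤⟨ ℕ.^-monoʳ-≤ 2 (growth m m₀≤m) ⟩
    2 ^ (suc q * m ^ L)      ≤⟨ ℕ.^-monoʳ-≤ 2 (ℕ.*-monoˡ-≤ (m ^ L) q<p) ⟩
    2 ^ (p * m ^ L)          ≡⟨ cong (2 ^_) (ℕ.*-comm p (m ^ L)) ⟩
    2 ^ (m ^ L * p)          ≡⟨ ℕ.^-*-assoc 2 (m ^ L) p ⟨
    (2 ^ (m ^ L)) ^ p        ≤⟨ ℕ.^-monoˡ-≤ p (ℕ.<⇒≤ below) ⟩
    r ^ p                    ∎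
    where
    Q≤ : Q s r ≤ (2 ℕ.+ m) ^ L
    Q≤ = proj₂ (productDimension-correct (K s r)) _
           -- `code (suc m)` has messages of length `suc m ^ L`, enough for `r` by `above`, and
           -- words of length `(2 + m) ^ L`.
           (code⇒representation (code (suc m) (unitDifferences s)) above)

theorem1p1 : ∀ (s : ℕ) → 2 ≤ s → ∀ (δ : ℚᵘ) → 0ℚᵘ < δ →
    ∃[ r₀ ] (∀ (r : ℕ) → 2 ≤ r → r₀ ≤ r →
    ((1ℚᵘ - δ) ·log₂ r ≤ʳ Q s r) × (Q s r ≤ˡ (1ℚᵘ + δ) ·log₂ r))
theorem1p1 s 2≤s δ 0<δ
  with r₀ , upper ← Q-upper (1ℚᵘ + δ) (ℚᵘ.+-monoʳ-< 1ℚᵘ 0<δ) s (ℕ.<⇒≤ 2≤s) =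
  r₀ , λ r 2≤r r₀≤r →
    Q-lower (1ℚᵘ - δ) (ℚᵘ.+-monoʳ-≤ 1ℚᵘ (ℚᵘ.neg-mono-≤ (ℚᵘ.<⇒≤ 0<δ))) s r 2≤s 2≤r ,
    upper r r₀≤r
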